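{- For each $n\ge1$, there exists a Borel unlayered toast on $F(2^{\mathbb{Z}^n})$ (with respect to the Schreier graph of the shift action of $\mathbb{Z}^n$ with the standard generators).
   Context: $\mathbb{Z}^n$ acts on $2^{\mathbb{Z}^n}=\{0,1\}^{\mathbb{Z}^n}$ by $(g\cdot x)(h)=x(g+h)$, and $F(2^{\mathbb{Z}^n})=\{x:\forall g\in\mathbb{Z}^n\setminus\{0\},\ g\cdot x\ne x\}$. The Schreier graph $\Gamma$ on $X=F(2^{\mathbb{Z}^n})$ has edges $(x,s\cdot x)$ for $s\in\{\pm e_1,\dots,\pm e_n\}$. $\rho_\Gamma$ is the shortest-path metric on the connected components of $\Gamma$ (which are the orbits), and $E_\Gamma$ is the equivalence relation whose classes are these components. A sequence $\{T_n\}$, where each $T_n\subseteq E_\Gamma$ is an equivalence relation on a subset $\mathrm{dom}(T_n)$ of $X$, is an (unlayered) toast if: (1) each $T_n$-class is finite; (2) $\bigcup_n\mathrm{dom}(T_n)=X$; (3) for each $T_n$-class $C$ and each $T_m$-class $C'$ with $m>n$, if $C\cap C'\ne\varnothing$ then $C\subseteq C'$; (4) for each $T_n$-class $C$ there are $m>n$ and a $T_m$-class $C'$ with $C\subseteq C'\setminus\partial C'$, where $\partial C'=\{x\in C':\rho_\Gamma(x,X\setminus C')=1\}$. It is Borel if each $\mathrm{dom}(T_n)$ is Borel and each $T_n$ is a Borel equivalence relation on $\mathrm{dom}(T_n)$. -}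

module Defs where

open import Level using (0ℓ)
open import Data.Nat.Base using (ℕ; zero; suc; _≤_; _<_)
open import Data.Integer.Base as ℤ using (ℤ; 0ℤ; 1ℤ; -_)
open import Data.Bool.Base using (Bool)
open import Data.Fin.Base using (Fin)
open import Data.Vec.Base as Vec using (Vec; replicate; zipWith; _[_]≔_)
open import Data.List.Base using (List)
open import Data.List.Relation.Unary.All using (All)
import Data.List.Membership.Setoid as Membership
open import Data.Product.Base using (Σ; Σ-syntax; ∃; ∃-syntax; _×_; _,_; proj₁; uncurry)
open import Data.Sum.Base using (_⊎_)
open import Relation.Nullary.Negation.Core using (¬_)
open import Relation.Unary using (Pred; _∈_; _⊆_; _≐_; _≬_; _∖_; ∁; ⋃)
open import Relation.Binary using (Rel; Setoid; _Respects_; _Respects₂_; Symmetric; Transitive)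
import Relation.Binary.Construct.On as On
open import Relation.Binary.PropositionalEquality using (_≡_; _≢_; _≗_; _→-setoid_)

-- A topology on A is presented by basic neighbourhoods: N i x is the basic
-- neighbourhood of x with index i.
module Topology {A I : Set} (N : I → A → Pred A 0ℓ) where

  IsOpen : Pred A 0ℓ → Set
  IsOpen U = ∀ x → x ∈ U → ∃[ i ] N i x ⊆ U

  -- The σ-algebra generated by the open sets.  Subsets are predicates, so
  -- closure under extensional equality has to be a clause of its own.
  data IsBorel : Pred A 0ℓ → Set₁ where
    open-set   : ∀ {U} → IsOpen U → IsBorel U
    complement : ∀ {B} → IsBorel B → IsBorel (∁ B)
    union      : ∀ {B : ℕ → Pred A 0ℓ} → (∀ k → IsBorel (B k)) → IsBorel (⋃ ℕ B)
    resp-≐     : ∀ {B C} → B ≐ C → IsBorel B → IsBorel C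

ProductNbhd : {A I B J : Set} → (I → A → Pred A 0ℓ) → (J → B → Pred B 0ℓ) →
              I × J → A × B → Pred (A × B) 0ℓ
ProductNbhd N M (i , j) (a , b) (a′ , b′) = a′ ∈ N i a × b′ ∈ M j b

record EquivalenceOnSubset (X : Setoid 0ℓ 0ℓ) : Set₁ where
  open Setoid X using (Carrier; _≈_)
  infix 4 _∼_
  field
    dom      : Pred Carrier 0ℓ
    _∼_      : Rel Carrier 0ℓ
    dom-resp : dom Respects _≈_
    ∼-resp   : _∼_ Respects₂ _≈_
    ∼⇒dom    : ∀ {x y} → x ∼ y → x ∈ dom × y ∈ dom
    refl     : ∀ {x} → x ∈ dom → x ∼ x
    sym      : Symmetric _∼_
    trans    : Transitive _∼_

  class : Carrier → Pred Carrier 0ℓ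
  class x y = x ∼ y

module Graph (X : Setoid 0ℓ 0ℓ) (Edge : Rel (Setoid.Carrier X) 0ℓ) where
  open Setoid X using (Carrier; _≈_)
  open EquivalenceOnSubset using (dom; _∼_; class)

  Walk : ℕ → Rel Carrier 0ℓ
  Walk zero    x y = x ≈ y
  Walk (suc k) x y = ∃[ z ] Edge x z × Walk k z y

  Connected : Rel Carrier 0ℓ
  Connected x y = ∃[ k ] Walk k x y

  -- ρ(x , y) = k
  Distance : Carrier → Carrier → ℕ → Set
  Distance x y k = Walk k x y × (∀ j → Walk j x y → k ≤ j)

  -- ρ(x , S) = k, the least distance from x to a point of S; points of S in
  -- other components count as infinitely far away.
  DistanceToSet : Carrier → Pred Carrier 0ℓ → ℕ → Set
  DistanceToSet x S k =
    (∃[ y ] y ∈ S × Distance x y k) ×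
    (∀ y j → y ∈ S → Distance x y j → k ≤ j)

  ∂ : Pred Carrier 0ℓ → Pred Carrier 0ℓ
  ∂ C x = x ∈ C × DistanceToSet x (∁ C) 1

  IsFinite : Pred Carrier 0ℓ → Set
  IsFinite C = ∃[ xs ] C ⊆ λ y → Membership._∈_ X y xs

  -- A class of T k is given by a representative in dom (T k).
  record IsUnlayeredToast (T : ℕ → EquivalenceOnSubset X) : Set where
    field
      ⊆-connected : ∀ k {x y} → _∼_ (T k) x y → Connected x y
      finite      : ∀ k x → x ∈ dom (T k) → IsFinite (class (T k) x)
      covers      : ∀ x → x ∈ ⋃ ℕ (λ k → dom (T k))
      nested      : ∀ k m → k < m → ∀ x y → x ∈ dom (T k) → y ∈ dom (T m) →
                    class (T k) x ≬ class (T m) y → class (T k) x ⊆ class (T m) y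
      absorbed    : ∀ k x → x ∈ dom (T k) →
                    ∃[ m ] k < m × ∃[ y ] y ∈ dom (T m) ×
                    class (T k) x ⊆ class (T m) y ∖ ∂ (class (T m) y)

module Shift (n : ℕ) where

  ℤⁿ : Set
  ℤⁿ = Vec ℤ n

  𝟎 : ℤⁿ
  𝟎 = replicate n 0ℤ

  infixl 6 _⊕_
  _⊕_ : ℤⁿ → ℤⁿ → ℤⁿ
  _⊕_ = zipWith ℤ._+_

  ⊖_ : ℤⁿ → ℤⁿ
  ⊖_ = Vec.map -_

  e : Fin n → ℤⁿ
  e i = 𝟎 [ i ]≔ 1ℤ

  IsGenerator : Pred ℤⁿ 0ℓ
  IsGenerator s = ∃[ i ] (s ≡ e i ⊎ s ≡ ⊖ e i)

  -- 2^ℤⁿ; its points are compared by pointwise equality _≗_.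
  Config : Set
  Config = ℤⁿ → Bool

  infixr 7 _·_
  _·_ : ℤⁿ → Config → Config
  (g · x) h = x (g ⊕ h)

  Free : Pred Config 0ℓ
  Free x = ∀ g → g ≢ 𝟎 → ¬ (g · x ≗ x)

  F : Setoid 0ℓ 0ℓ
  F = On.setoid {B = Σ Config Free} (ℤⁿ →-setoid Bool) proj₁

  open Setoid F using (Carrier)

  SchreierEdge : Rel Carrier 0ℓ
  SchreierEdge (x , _) (y , _) = ∃[ s ] IsGenerator s × y ≗ s · x

  -- The subspace topology from the product topology on 2^ℤⁿ: a basic
  -- neighbourhood of x fixes the values of x at finitely many coordinates.
  Nbhd : List ℤⁿ → Carrier → Pred Carrier 0ℓ
  Nbhd hs (x , _) (y , _) = All (λ h → y h ≡ x h) hs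

  record IsBorelSequence (T : ℕ → EquivalenceOnSubset F) : Set₁ where
    field
      dom-borel : ∀ k → Topology.IsBorel Nbhd (EquivalenceOnSubset.dom (T k))
      ∼-borel   : ∀ k → Topology.IsBorel (ProductNbhd Nbhd Nbhd)
                          (uncurry (EquivalenceOnSubset._∼_ (T k)))

  open Graph F SchreierEdge public using (IsUnlayeredToast)

  BorelUnlayeredToast : Set₁
  BorelUnlayeredToast = Σ[ T ∈ (ℕ → EquivalenceOnSubset F) ]
                          IsUnlayeredToast T × IsBorelSequence T

{-# OPTIONS --safe #-}

-- Points that share a finite pattern of coordinates excluding all periods g with 0 < |g| ≤ r are r-separated, and
-- countably many such patterns cover the free part, so greedy selection yields Borel maximal r-separated subsets.
-- For a scale R, choose markers M₀, M₁, …, each a maximal 6R-separated subset of the points not yet R-close to an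
-- earlier Mᵢ.  By packing, 1 + 13ⁿ of them are jointly R-dense, a number that does not depend on R.  Along scales
-- R₀ < R₁ < …, every orbit therefore has an index j such that each of its points lies arbitrarily deep inside the
-- 2Rₖ-ball around some marker of Mⱼ at scale Rₖ, for infinitely many k.  Using the least such j on each orbit leaves a
-- single 6Rₖ-separated marker set per scale.  The toast at level k consists of its 2Rₖ-balls, saturated under the
-- pieces of lower levels; separation keeps the pieces of one level disjoint, saturation makes levels nested, and
-- depth gives covering and absorption.

module Submission where

open import Level using (0ℓ)
open import Axiom.ExcludedMiddle using (ExcludedMiddle)
open import Data.Bool.Base using (Bool; true; false)
open import Data.Empty using (⊥)
open import Data.Fin.Base as Fin using (Fin; combine; fromℕ<)
open import Data.Fin.Properties as Fin using (pigeonhole; combine-injective)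
open import Data.Integer.Base as ℤ using (ℤ; 0ℤ; +_; -[1+_]; ∣_∣)
import Data.Integer.Properties as ℤ
open import Data.Integer.Tactic.RingSolver using (solve-∀)
open import Data.List.Base as List using (List; []; _∷_; _++_; upTo; cartesianProductWith)
open import Data.List.Membership.Propositional using () renaming (_∈_ to _∈ˡ_)
open import Data.List.Membership.Propositional.Properties
  using (∈-cartesianProductWith⁺; ∈-++⁺ˡ; ∈-++⁺ʳ; ∈-map⁺; ∈-upTo⁺; ∈-upTo⁻)
open import Data.List.Properties using (∷-injectiveˡ; ∷-injectiveʳ; map-cong-local)
open import Data.List.Relation.Unary.All as All using (All; []; _∷_)
import Data.List.Relation.Unary.All.Properties as All
open import Data.List.Relation.Unary.Any as Any using (here; there)
import Data.List.Relation.Unary.Any.Properties as Any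
open import Data.Nat.Base
  using (ℕ; zero; suc; _+_; _*_; _∸_; _^_; _⊔_; _≤_; _<_; _≥_; _≤′_; _<′_; ≤′-refl; ≤′-step; z≤n; s≤s; NonZero)
open import Data.Nat.Binary.Base as ℕᵇ using (ℕᵇ; 2[1+_]; 1+[2_])
open import Data.Nat.Binary.Properties as ℕᵇ using (2[1+_]-injective; 1+[2_]-injective)
open import Data.Nat.DivMod using (_/_; _%_; m≡m%n+[m/n]*n; m%n<n; m<n*o⇒m/o<n)
open import Data.Nat.Properties
open import Data.Nat.Tactic.RingSolver using () renaming (solve-∀ to solve-ℕ)
open import Data.Product.Base using (Σ-syntax; ∃-syntax; _×_; _,_; proj₁; proj₂; uncurry)
open import Data.Sum.Base using (_⊎_; inj₁; inj₂; [_,_])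
open import Data.Vec.Base using (Vec; []; _∷_)
open import Data.Vec.Properties
  using (zipWith-assoc; zipWith-comm; zipWith-identityˡ; zipWith-identityʳ; zipWith-inverseˡ; zipWith-inverseʳ)
open import Data.Vec.Relation.Binary.Pointwise.Inductive as Pointwise using (Pointwise; []; _∷_)
open import Function.Base using (_∘_; id)
open import Relation.Binary using (Rel; Setoid)
open import Relation.Binary.Definitions using (tri<; tri≈; tri>)
open import Relation.Binary.PropositionalEquality
  using (_≡_; _≢_; refl; sym; trans; cong; cong₂; subst; subst₂; module ≡-Reasoning)
open import Relation.Nullary using (¬_; yes; no; contradiction)
open import Relation.Unary using (Pred; ⋃)
open import Defs

-- Closure properties of Borel sets

module Borel (em : ExcludedMiddle 0ℓ) {A I : Set} (N : I → A → Pred A 0ℓ) where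
  open Topology N public

  private
    stable : {P : Set} → ¬ ¬ P → P
    stable {P} ¬¬p with em {P}
    ... | yes p = p
    ... | no ¬p = contradiction ¬p ¬¬p

  -- By excluded middle the set is empty or everything. This admits side conditions such as `g ≢ 𝟎`
  -- or `Near r 𝟎 g` into Borel formulas.
  borel-const : (P : Set) → IsBorel (λ _ → P)
  borel-const P with em {P}
  ... | no ¬p = open-set λ _ p → contradiction p ¬p
  ... | yes p = resp-≐ ((λ _ → p) , λ _ z → z) (complement (open-set {U = λ _ → ⊥} λ _ ()))

  borel-∪ : ∀ {B C} → IsBorel B → IsBorel C → IsBorel (λ x → B x ⊎ C x)
  borel-∪ {B} {C} b c = resp-≐ (to , from) (union {B = family} borel-family)
    where
    family : ℕ → Pred A 0ℓ
    family zero    = B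
    family (suc _) = C
    borel-family : ∀ k → IsBorel (family k)
    borel-family zero    = b
    borel-family (suc _) = c
    to : ∀ {x} → ⋃ ℕ family x → B x ⊎ C x
    to (zero  , p) = inj₁ p
    to (suc _ , p) = inj₂ p
    from : ∀ {x} → B x ⊎ C x → ⋃ ℕ family x
    from (inj₁ p) = 0 , p
    from (inj₂ p) = 1 , p

  borel-∩ : ∀ {B C} → IsBorel B → IsBorel C → IsBorel (λ x → B x × C x)
  borel-∩ b c = resp-≐
    ( (λ n → stable (n ∘ inj₁) , stable (n ∘ inj₂))
    , (λ (p , q) → [ (λ ¬p → ¬p p) , (λ ¬q → ¬q q) ]))
    (complement (borel-∪ (complement b) (complement c)))

  borel-⇒ : ∀ {B C} → IsBorel B → IsBorel C → IsBorel (λ x → B x → C x)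
  borel-⇒ {B} {C} b c = resp-≐ ((λ p x → [ (λ ¬x → contradiction x ¬x) , id ] p) , from)
    (borel-∪ (complement b) c)
    where
    from : ∀ {x} → (B x → C x) → ¬ B x ⊎ C x
    from {x} f with em {B x}
    ... | yes p = inj₂ (f p)
    ... | no ¬p = inj₁ ¬p

  module _ {J : Set}
    (borel-⋃ : ∀ {B : J → Pred A 0ℓ} → (∀ j → IsBorel (B j)) → IsBorel (⋃ J B)) where

    -- De Morgan. Countability of `J` enters only through `borel-⋃`, so `ℕ` and `ℤⁿ` are treated
    -- alike.
    borel-⋂ : ∀ {B : J → Pred A 0ℓ} → (∀ j → IsBorel (B j)) → IsBorel (λ x → ∀ j → B j x)
    borel-⋂ b = resp-≐ ((λ n j → stable (λ ¬p → n (j , ¬p))) , (λ p (j , ¬p) → ¬p (p j)))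
      (complement (borel-⋃ (complement ∘ b)))

  borel-⋃ℤ : {B : ℤ → Pred A 0ℓ} → (∀ z → IsBorel (B z)) → IsBorel (⋃ ℤ B)
  borel-⋃ℤ {B} b = resp-≐ (to , from) (borel-∪ (union (b ∘ +_)) (union (b ∘ -[1+_])))
    where
    to : ∀ {x} → ⋃ ℕ (B ∘ +_) x ⊎ ⋃ ℕ (B ∘ -[1+_]) x → ⋃ ℤ B x
    to (inj₁ (k , p)) = + k , p
    to (inj₂ (k , p)) = -[1+ k ] , p
    from : ∀ {x} → ⋃ ℤ B x → ⋃ ℕ (B ∘ +_) x ⊎ ⋃ ℕ (B ∘ -[1+_]) x
    from (+ k , p)      = inj₁ (k , p)
    from (-[1+ k ] , p) = inj₂ (k , p)

  borel-⋃ℤⁿ : ∀ {n} {B : Vec ℤ n → Pred A 0ℓ} → (∀ g → IsBorel (B g)) → IsBorel (⋃ (Vec ℤ n) B)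
  borel-⋃ℤⁿ {zero}      b = resp-≐ (([] ,_) , λ { ([] , p) → p }) (b [])
  borel-⋃ℤⁿ {suc n} {B} b =
    resp-≐ ((λ (z , g , p) → z ∷ g , p) , λ { (z ∷ g , p) → z , g , p })
           (borel-⋃ℤ (λ z → borel-⋃ℤⁿ {B = λ g → B (z ∷ g)} (λ g → b (z ∷ g))))

  borel-⋂ℤⁿ : ∀ {n} {B : Vec ℤ n → Pred A 0ℓ} → (∀ g → IsBorel (B g)) → IsBorel (λ x → ∀ g → B g x)
  borel-⋂ℤⁿ = borel-⋂ borel-⋃ℤⁿ

  -- A basic neighbourhood contains every point equivalent to its centre, so open sets are
  -- invariant; the other clauses follow by induction. This gives transport along `≋`, since
  -- composed shifts agree only pointwise.
  borel-resp : (_≈_ : A → A → Set) → (∀ {x y} → x ≈ y → y ≈ x) → (∀ i {x y} → x ≈ y → N i x y) →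
               ∀ {B} → IsBorel B → ∀ {x y} → x ≈ y → B x → B y
  borel-resp _≈_ symm near (open-set o) x≈y p =
    proj₂ (o _ p) (near _ x≈y)
  borel-resp _≈_ symm near (complement b) x≈y ¬p =
    λ q → ¬p (borel-resp _≈_ symm near b (symm x≈y) q)
  borel-resp _≈_ symm near (union b) x≈y (k , p) =
    k , borel-resp _≈_ symm near (b k) x≈y p
  borel-resp _≈_ symm near (resp-≐ (B⊆C , C⊆B) b) x≈y p =
    B⊆C (borel-resp _≈_ symm near b x≈y (C⊆B p))

borel-preimage : {A I B J : Set} {N : I → A → Pred A 0ℓ} {M : J → B → Pred B 0ℓ} (f : A → B) →
                 (∀ j x → ∃[ i ] (∀ {y} → N i x y → M j (f x) (f y))) →
                 ∀ {U} → Topology.IsBorel M U → Topology.IsBorel N (U ∘ f)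
borel-preimage f cont (Topology.open-set o) = Topology.open-set λ x p →
  let j , M⊆U = o (f x) p ; i , N⊆M = cont j x in i , λ q → M⊆U (N⊆M q)
borel-preimage f cont (Topology.complement b) = Topology.complement (borel-preimage f cont b)
borel-preimage f cont (Topology.union b) = Topology.union (λ k → borel-preimage f cont (b k))
borel-preimage f cont (Topology.resp-≐ (s , t) b) =
  Topology.resp-≐ ((λ {x} → s {f x}) , (λ {x} → t {f x})) (borel-preimage f cont b)

-- Two facts about finite lists

uniform-bound : {A : Set} (Q : A → ℕ → Set) → (∀ {a r s} → r ≤ s → Q a r → Q a s) →
                ∀ {as} → All (λ a → ∃[ r ] Q a r) as → ∃[ r ] All (λ a → Q a r) as
uniform-bound Q mono []             = 0 , []
uniform-bound Q mono ((r , q) ∷ qs) with uniform-bound Q mono qs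
... | s , qs′ = r ⊔ s , mono (m≤m⊔n r s) q ∷ All.map (mono (m≤n⊔m r s)) qs′

map-≡⇒≡ : {A B : Set} {f f′ : A → B} (xs : List A) → List.map f xs ≡ List.map f′ xs →
            ∀ {x} → x ∈ˡ xs → f x ≡ f′ x
map-≡⇒≡ (_ ∷ _)  eq (here refl) = ∷-injectiveˡ eq
map-≡⇒≡ (_ ∷ xs) eq (there x∈)  = map-≡⇒≡ xs (∷-injectiveʳ eq) x∈

-- The sup metric on ℤⁿ, through its closed balls

Near : ℕ → ∀ {n} → Vec ℤ n → Vec ℤ n → Set
Near r = Pointwise (λ a b → ∣ a ℤ.- b ∣ ≤ r)

module _ {n : ℕ} where
  open Shift n

  ⊕-assoc : ∀ f g h → (f ⊕ g) ⊕ h ≡ f ⊕ (g ⊕ h)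
  ⊕-assoc = zipWith-assoc ℤ.+-assoc

  ⊕-comm : ∀ g h → g ⊕ h ≡ h ⊕ g
  ⊕-comm = zipWith-comm ℤ.+-comm

  ⊕-identityˡ : ∀ g → 𝟎 ⊕ g ≡ g
  ⊕-identityˡ = zipWith-identityˡ ℤ.+-identityˡ

  ⊕-identityʳ : ∀ g → g ⊕ 𝟎 ≡ g
  ⊕-identityʳ = zipWith-identityʳ ℤ.+-identityʳ

  ⊖-inverseˡ : ∀ g → (⊖ g) ⊕ g ≡ 𝟎
  ⊖-inverseˡ = zipWith-inverseˡ ℤ.+-inverseˡ

  ⊖-inverseʳ : ∀ g → g ⊕ (⊖ g) ≡ 𝟎
  ⊖-inverseʳ = zipWith-inverseʳ ℤ.+-inverseʳ

  ⊖-cancelˡ : ∀ g h → (⊖ g) ⊕ (g ⊕ h) ≡ h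
  ⊖-cancelˡ g h = trans (sym (⊕-assoc _ g h)) (trans (cong (_⊕ h) (⊖-inverseˡ g)) (⊕-identityˡ h))

  ⊖-cancelʳ : ∀ g h → g ⊕ ((⊖ g) ⊕ h) ≡ h
  ⊖-cancelʳ g h = trans (sym (⊕-assoc g _ h)) (trans (cong (_⊕ h) (⊖-inverseʳ g)) (⊕-identityˡ h))

  near-refl : ∀ {r} {g : ℤⁿ} → Near r g g
  near-refl = Pointwise.refl λ {z} → subst (_≤ _) (cong ∣_∣ (sym (ℤ.i≡j⇒i-j≡0 {z} refl))) z≤n

  near-sym : ∀ {r} {g h : ℤⁿ} → Near r g h → Near r h g
  near-sym = Pointwise.sym λ {a} {b} → subst (_≤ _) (ℤ.∣i-j∣≡∣j-i∣ a b)

  near-trans : ∀ {r s} {f g h : ℤⁿ} → Near r f g → Near s g h → Near (r + s) f h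
  near-trans = Pointwise.trans λ {a} {b} {c} p q →
    ≤-trans (subst (λ z → ∣ z ∣ ≤ ∣ a ℤ.- b ∣ + ∣ b ℤ.- c ∣) (ℤ.+-minus-telescope a b c)
                   (ℤ.∣i+j∣≤∣i∣+∣j∣ (a ℤ.- b) (b ℤ.- c)))
            (+-mono-≤ p q)

  near-mono : ∀ {r s} {g h : ℤⁿ} → r ≤ s → Near r g h → Near s g h
  near-mono r≤s = Pointwise.map λ p → ≤-trans p r≤s

near-shift : ∀ {r n} (c : Vec ℤ n) {g h} → Near r g h → Near r (Shift._⊕_ n c g) (Shift._⊕_ n c h)
near-shift []      []       = []
near-shift (c ∷ cs) (_∷_ {x = a} {y = b} p ps) =
  subst (_≤ _) (cong ∣_∣ (eq c a b)) p ∷ near-shift cs ps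
  where
  eq : ∀ c a b → a ℤ.- b ≡ (c ℤ.+ a) ℤ.- (c ℤ.+ b)
  eq = solve-∀

radius : ∀ {n} (g : Vec ℤ n) → ∃[ r ] Near r (Shift.𝟎 n) g
radius []      = 0 , []
radius (z ∷ g) = let r , p = radius g in
  ∣ 0ℤ ℤ.- z ∣ ⊔ r , m≤m⊔n _ r ∷ near-mono (m≤n⊔m _ r) p

module _ {n : ℕ} where
  open Shift n

  near-shift-𝟎 : ∀ {r} {g h : ℤⁿ} → Near r 𝟎 h → Near r g (g ⊕ h)
  near-shift-𝟎 {r} {g} {h} p = subst (λ z → Near r z (g ⊕ h)) (⊕-identityʳ g) (near-shift g p)

  near-⊖ : ∀ {r} {g h : ℤⁿ} → Near r g h → Near r 𝟎 ((⊖ g) ⊕ h)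
  near-⊖ {r} {g} {h} p = subst (λ z → Near r z ((⊖ g) ⊕ h)) (⊖-inverseˡ g) (near-shift (⊖ g) p)

-- Boxes in ℤⁿ and the packing bound

interval : ℕ → List ℤ
interval r = List.map +_ (upTo (suc r)) ++ List.map -[1+_] (upTo r)

box : ℕ → ∀ n → List (Vec ℤ n)
box r zero    = [] ∷ []
box r (suc n) = cartesianProductWith _∷_ (interval r) (box r n)

∈-interval : ∀ {r} z → ∣ 0ℤ ℤ.- z ∣ ≤ r → z ∈ˡ interval r
∈-interval (+ zero)  p = here refl
∈-interval {r} (+ suc m) p = ∈-++⁺ˡ (∈-map⁺ +_ (∈-upTo⁺ (s≤s p)))
∈-interval {r} -[1+ m ] p = ∈-++⁺ʳ (List.map +_ (upTo (suc r))) (∈-map⁺ -[1+_] (∈-upTo⁺ p))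

∈-box : ∀ {r n} (g : Vec ℤ n) → Near r (Shift.𝟎 n) g → g ∈ˡ box r n
∈-box []      []       = here refl
∈-box (z ∷ g) (p ∷ ps) = ∈-cartesianProductWith⁺ _∷_ (∈-interval z p) (∈-box g ps)

-- The interval of radius 6R splits into 13 cells whose points are pairwise R-close.
module Packing (R : ℕ) .{{_ : NonZero R}} where

  -- Translation by `6 * R` lands among the naturals below `13 * R`, where the quotient by `R` can
  -- serve as the cell.
  offset : ∀ z → ∣ z ∣ ≤ 6 * R → ∃[ a ] + a ≡ + (6 * R) ℤ.+ z × a < 13 * R
  offset (+ m) p = 6 * R + m , refl , (begin-strict
    6 * R + m     ≤⟨ +-monoʳ-≤ (6 * R) p ⟩
    6 * R + 6 * R ≡⟨ *-distribʳ-+ R 6 6 ⟨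
    12 * R        <⟨ *-monoˡ-< R (n<1+n 12) ⟩
    13 * R        ∎)
    where open ≤-Reasoning
  offset -[1+ m ] p = 6 * R ∸ suc m , sym (ℤ.⊖-≥ p) , (begin-strict
    6 * R ∸ suc m ≤⟨ m∸n≤m (6 * R) (suc m) ⟩
    6 * R         <⟨ *-monoˡ-< R {6} {13} (m≤m+n 7 6) ⟩
    13 * R        ∎)
    where open ≤-Reasoning

  index : ∀ z → ∣ 0ℤ ℤ.- z ∣ ≤ 6 * R → ∃[ a ] + a ≡ + (6 * R) ℤ.+ z × a < 13 * R
  index z = offset z ∘ subst (_≤ 6 * R) (trans (ℤ.∣i-j∣≡∣j-i∣ 0ℤ z) (cong ∣_∣ (ℤ.+-identityʳ z)))

  interval-cell : ∀ z → ∣ 0ℤ ℤ.- z ∣ ≤ 6 * R → Fin 13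
  interval-cell z p = let a , _ , a<13R = index z p in fromℕ< (m<n*o⇒m/o<n {a} {13} {R} a<13R)

  -- Equal quotients cancel, leaving a difference of two remainders below `R`.
  /-≡⇒close : ∀ a b → a / R ≡ b / R → ∣ + a ℤ.- + b ∣ ≤ R
  /-≡⇒close a b eq = begin
    ∣ + a ℤ.- + b ∣                     ≡⟨ cong₂ (λ u v → ∣ + u ℤ.- + v ∣) (m≡m%n+[m/n]*n a R) b≡ ⟩
    ∣ + (a % R + q) ℤ.- + (b % R + q) ∣ ≡⟨ cong ∣_∣ (cancel (+ (a % R)) (+ (b % R)) (+ q)) ⟩
    ∣ + (a % R) ℤ.- + (b % R) ∣         ≡⟨ cong ∣_∣ (ℤ.m-n≡m⊖n (a % R) (b % R)) ⟩
    ∣ a % R ℤ.⊖ b % R ∣                 ≤⟨ ℤ.∣m⊝n∣≤m⊔n (a % R) (b % R) ⟩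
    a % R ⊔ b % R                       ≤⟨ ⊔-lub (<⇒≤ (m%n<n a R)) (<⇒≤ (m%n<n b R)) ⟩
    R                                   ∎
    where
    open ≤-Reasoning
    q = a / R * R
    b≡ : b ≡ b % R + q
    b≡ = trans (m≡m%n+[m/n]*n b R) (cong (λ q → b % R + q * R) (sym eq))
    cancel : ∀ x y z → (x ℤ.+ z) ℤ.- (y ℤ.+ z) ≡ x ℤ.- y
    cancel = solve-∀

  interval-cell-close : ∀ z w p q → interval-cell z p ≡ interval-cell w q → ∣ z ℤ.- w ∣ ≤ R
  interval-cell-close z w p q eq =
    let a , a≡ , a< = index z p
        b , b≡ , b< = index w q
        a/R≡b/R = Fin.fromℕ<-injective (a / R) (b / R) (m<n*o⇒m/o<n {a} {13} {R} a<) (m<n*o⇒m/o<n {b} {13} {R} b<) eq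
    in subst (_≤ R) (cong ∣_∣ (trans (cong₂ ℤ._-_ a≡ b≡) (cancel (+ (6 * R)) z w))) (/-≡⇒close a b a/R≡b/R)
    where
    cancel : ∀ c x y → (c ℤ.+ x) ℤ.- (c ℤ.+ y) ≡ x ℤ.- y
    cancel = solve-∀

  cell : ∀ {n} {g : Vec ℤ n} → Near (6 * R) (Shift.𝟎 n) g → Fin (13 ^ n)
  cell {g = []}    []       = Fin.zero
  cell {g = z ∷ _} (p ∷ ps) = combine (interval-cell z p) (cell ps)

  cell-close : ∀ {n} {g h : Vec ℤ n} (p : Near (6 * R) (Shift.𝟎 n) g) (q : Near (6 * R) (Shift.𝟎 n) h) →
               cell p ≡ cell q → Near R g h
  cell-close {g = []}    {[]}    []       []       _  = []
  cell-close {g = z ∷ _} {w ∷ _} (p ∷ ps) (q ∷ qs) eq =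
    let eq₁ , eq₂ = combine-injective (interval-cell z p) (cell ps) (interval-cell w q) (cell qs) eq
    in interval-cell-close z w p q eq₁ ∷ cell-close ps qs eq₂

  packing : ∀ {n} (g : Fin (suc (13 ^ n)) → Vec ℤ n) → (∀ i → Near (6 * R) (Shift.𝟎 n) (g i)) →
            ∃[ i ] ∃[ j ] i Fin.< j × Near R (g i) (g j)
  packing g near =
    let i , j , i<j , eq = pigeonhole (n<1+n _) (cell ∘ near)
    in i , j , i<j , cell-close (near i) (near j) eq

-- Tiles in the coordinates of one orbit

-- The diameter bounds the pieces of all levels below k.  Since scale k exceeds it, 4 scale k + 2 diameter k ≤ 6 scale k,
-- so two pieces of level k that meet have the same centre.
diameter : ℕ → ℕ
diameter zero    = 0
diameter (suc k) = (d + (r + r)) + ((r + r) + d)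
  where
  d = diameter k
  r = suc d

scale : ℕ → ℕ
scale k = suc (diameter k)

diameter-mono : ∀ k → diameter k ≤ diameter (suc k)
diameter-mono k = ≤-trans (m≤m+n _ _) (m≤m+n _ _)

n≤diameter : ∀ k → k ≤ diameter k
n≤diameter zero    = z≤n
n≤diameter (suc k) = ≤-trans (s≤s (n≤diameter k))
  (≤-trans (≤-trans (m≤m+n (suc d) (suc d)) (m≤n+m _ d)) (m≤m+n _ _))
  where d = diameter k

separation-bound : ∀ d → let r = suc d in ((r + r) + d) + (d + (r + r)) ≤ 6 * r
separation-bound d = begin
  ((r + r) + d) + (d + (r + r)) ≤⟨ +-mono-≤ (+-monoʳ-≤ (r + r) (n≤1+n d)) (+-monoˡ-≤ (r + r) (n≤1+n d)) ⟩
  ((r + r) + r) + (r + (r + r)) ≡⟨ eq r ⟩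
  6 * r                         ∎
  where
  open ≤-Reasoning
  r = suc d
  eq : ∀ r → ((r + r) + r) + (r + (r + r)) ≡ 6 * r
  eq = solve-ℕ

module _ {n : ℕ} where
  open Shift n

  -- The ball has twice the radius at which all marker sets together are dense; the surplus later
  -- makes points lie deep inside tiles.
  Saturation : ℕ → Rel ℤⁿ 0ℓ → ℤⁿ → Pred ℤⁿ 0ℓ
  Saturation r _~_ m a = ∃[ a′ ] a ~ a′ × Near (r + r) a′ m

  Joined : Pred ℤⁿ 0ℓ → ℕ → Rel ℤⁿ 0ℓ → Rel ℤⁿ 0ℓ
  Joined P r _~_ a b = ∃[ m ] P m × Saturation r _~_ m a × Saturation r _~_ m b

  -- Equality together with every `SameTile P i` for `i < k`; equality keeps it reflexive off the
  -- tiles.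
  Below : (ℕ → Pred ℤⁿ 0ℓ) → ℕ → Rel ℤⁿ 0ℓ
  Below P zero    a b = a ≡ b
  Below P (suc k) a b = Below P k a b ⊎ Joined (P k) (scale k) (Below P k) a b

  SameTile : (ℕ → Pred ℤⁿ 0ℓ) → ℕ → Rel ℤⁿ 0ℓ
  SameTile P k = Joined (P k) (scale k) (Below P k)

  module _ {P Q : ℕ → Pred ℤⁿ 0ℓ} (c : ℤⁿ) (P⇒Q : ∀ k m → P k m → Q k (c ⊕ m)) where

    -- Tiles are built from marker positions and distances alone, so they move along with the
    -- markers. This is what makes the tiling of an orbit independent of the base point.
    below-shift : ∀ k {a b} → Below P k a b → Below Q k (c ⊕ a) (c ⊕ b)
    tile-shift : ∀ k {a b} → SameTile P k a b → SameTile Q k (c ⊕ a) (c ⊕ b)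

    below-shift zero    refl     = refl
    below-shift (suc k) (inj₁ e) = inj₁ (below-shift k e)
    below-shift (suc k) (inj₂ t) = inj₂ (tile-shift k t)
    tile-shift k (m , p , (a′ , e , near) , (b′ , e′ , near′)) =
      c ⊕ m , P⇒Q k m p ,
      (c ⊕ a′ , below-shift k e , near-shift c near) ,
      (c ⊕ b′ , below-shift k e′ , near-shift c near′)

  module _ {P : ℕ → Pred ℤⁿ 0ℓ} where

    tile-sym : ∀ k {a b} → SameTile P k a b → SameTile P k b a
    tile-sym k (m , p , sa , sb) = m , p , sb , sa

    below-refl : ∀ k {a} → Below P k a a
    below-refl zero    = refl
    below-refl (suc k) = inj₁ (below-refl k)

    below-sym : ∀ k {a b} → Below P k a b → Below P k b a
    below-sym zero    refl     = refl
    below-sym (suc k) (inj₁ e) = inj₁ (below-sym k e)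
    below-sym (suc k) (inj₂ t) = inj₂ (tile-sym k t)

    -- Inside a tile, the path from `a` through `a′`, the centre and `b′` to `b` has four legs,
    -- whose bounds add up to `diameter (suc k)`.
    below-near : ∀ k {a b} → Below P k a b → Near (diameter k) a b
    tile-near : ∀ k {a b} → SameTile P k a b → Near (diameter (suc k)) a b

    below-near zero    refl     = near-refl
    below-near (suc k) (inj₁ e) = near-mono (diameter-mono k) (below-near k e)
    below-near (suc k) (inj₂ t) = tile-near k t
    tile-near k (m , _ , (a′ , e , near) , (b′ , e′ , near′)) =
      near-trans (near-trans (below-near k e) near)
                 (near-trans (near-sym near′) (near-sym (below-near k e′)))

    below-mono : ∀ {k m} → k ≤′ m → ∀ {a b} → Below P k a b → Below P m a b
    below-mono ≤′-refl       e = e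
    below-mono (≤′-step k≤m) e = inj₁ (below-mono k≤m e)

    ball⇒tile : ∀ k {m a b} → P k m → Near (scale k + scale k) a m → Near (scale k + scale k) b m →
                 SameTile P k a b
    ball⇒tile k p near near′ = _ , p , (_ , below-refl k , near) , (_ , below-refl k , near′)

    module _ (separated : ∀ k {m m′} → P k m → P k m′ → Near (6 * scale k) m m′ → m ≡ m′) where

      tile-trans : ∀ k {a b c} → SameTile P k a b → SameTile P k b c → SameTile P k a c
      tile-trans k (m , p , sa , (_ , e , near)) (m′ , p′ , (_ , e′ , near′) , sc)
        with refl ← separated k p p′ (near-mono (separation-bound (diameter k))
               (near-trans (near-trans (near-sym near) (near-sym (below-near k e)))
                           (near-trans (below-near k e′) near′)))
        = m , p , sa , sc

      -- A tile of level `k` is a union of classes of `Below P k`, so steps of lower level never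
      -- leave it; the mixed cases reduce to this by symmetry.
      below-trans : ∀ k {a b c} → Below P k a b → Below P k b c → Below P k a c
      tile-below : ∀ k {a b c} → SameTile P k a b → Below P k b c → SameTile P k a c

      below-trans zero    refl     refl      = refl
      below-trans (suc k) (inj₁ e) (inj₁ e′) = inj₁ (below-trans k e e′)
      below-trans (suc k) (inj₁ e) (inj₂ t)  = inj₂ (tile-sym k (tile-below k (tile-sym k t) (below-sym k e)))
      below-trans (suc k) (inj₂ t) (inj₁ e)  = inj₂ (tile-below k t e)
      below-trans (suc k) (inj₂ t) (inj₂ t′) = inj₂ (tile-trans k t t′)
      tile-below k (m , p , sa , (b′ , e′ , near)) e =
        m , p , sa , (b′ , below-trans k (below-sym k e) e′ , near)

      -- For `k < m` the lower tile is part of `Below P m`, under which tiles of level `m` are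
      -- saturated; for `k = m` this is transitivity.
      tile-absorbs : ∀ {k m} → k ≤ m → ∀ {a b c} → SameTile P m a b → SameTile P k b c → SameTile P m a c
      tile-absorbs {k} {m} k≤m t t′ with m≤n⇒m<n∨m≡n k≤m
      ... | inj₁ k<m  = tile-below m t (below-mono (≤⇒≤′ k<m) (inj₂ t′))
      ... | inj₂ refl = tile-trans m t t′

-- Injective codes for a window size and its bits

-- Bijective base 2: the digits are 1 and 2, so no list is lost to leading zeros.
encodeBits : List Bool → ℕᵇ
encodeBits []           = ℕᵇ.zero
encodeBits (true  ∷ bs) = 2[1+ encodeBits bs ]
encodeBits (false ∷ bs) = 1+[2 encodeBits bs ]

encodeBits-injective : ∀ as bs → encodeBits as ≡ encodeBits bs → as ≡ bs
encodeBits-injective []           []           _  = refl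
encodeBits-injective []           (true  ∷ _)  ()
encodeBits-injective []           (false ∷ _)  ()
encodeBits-injective (true  ∷ _)  []           ()
encodeBits-injective (false ∷ _)  []           ()
encodeBits-injective (true  ∷ _)  (false ∷ _)  ()
encodeBits-injective (false ∷ _)  (true ∷ _)   ()
encodeBits-injective (true  ∷ as) (true  ∷ bs) eq = cong (true ∷_) (encodeBits-injective as bs (2[1+_]-injective eq))
encodeBits-injective (false ∷ as) (false ∷ bs) eq = cong (false ∷_) (encodeBits-injective as bs (1+[2_]-injective eq))

-- The size `s` is written in unary as `s` constructors `1+[2_]`, ended by one `2[1+_]`.
encode : ℕ → List Bool → ℕᵇ
encode zero    bs = 2[1+ encodeBits bs ]
encode (suc s) bs = 1+[2 encode s bs ]

encode-injective : ∀ s t {as bs} → encode s as ≡ encode t bs → s ≡ t × as ≡ bs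
encode-injective zero    zero    eq = refl , encodeBits-injective _ _ (2[1+_]-injective eq)
encode-injective zero    (suc t) ()
encode-injective (suc s) zero    ()
encode-injective (suc s) (suc t) eq =
  let s≡t , as≡bs = encode-injective s t (1+[2_]-injective eq) in cong suc s≡t , as≡bs

-- The shift on the free part

module Construction (em : ExcludedMiddle 0ℓ) (n : ℕ) where
  open Shift n
  open Setoid F using (Carrier) renaming (_≈_ to _≋_)
  module F  = Borel em Nbhd
  module F² = Borel em (ProductNbhd Nbhd Nbhd)
  open F using (IsBorel)

  ⊕-swap : ∀ g k h → g ⊕ (k ⊕ ((⊖ g) ⊕ h)) ≡ k ⊕ h
  ⊕-swap g k h = begin
    g ⊕ (k ⊕ ((⊖ g) ⊕ h)) ≡⟨ ⊕-assoc g k _ ⟨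
    (g ⊕ k) ⊕ ((⊖ g) ⊕ h) ≡⟨ cong (_⊕ ((⊖ g) ⊕ h)) (⊕-comm g k) ⟩
    (k ⊕ g) ⊕ ((⊖ g) ⊕ h) ≡⟨ ⊕-assoc k g _ ⟩
    k ⊕ (g ⊕ ((⊖ g) ⊕ h)) ≡⟨ cong (k ⊕_) (⊖-cancelʳ g h) ⟩
    k ⊕ h                 ∎
    where open ≡-Reasoning

  abstract
    -- The group is commutative, so a period of `g · x` is one of `x`, as evaluation at `(⊖ g) ⊕ h`
    -- shows.
    shift-free : ∀ g {x} → Free x → Free (g · x)
    shift-free g {x} free k k≢𝟎 period = free k k≢𝟎 λ h → begin
      x (k ⊕ h)                 ≡⟨ cong x (⊕-swap g k h) ⟨
      x (g ⊕ (k ⊕ ((⊖ g) ⊕ h))) ≡⟨ period ((⊖ g) ⊕ h) ⟩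
      x (g ⊕ ((⊖ g) ⊕ h))       ≡⟨ cong x (⊖-cancelʳ g h) ⟩
      x h                       ∎
      where open ≡-Reasoning

  shift : ℤⁿ → Carrier → Carrier
  shift g (x , free) = g · x , shift-free g free

  shift-𝟎 : ∀ x → shift 𝟎 x ≋ x
  shift-𝟎 (x , _) h = cong x (⊕-identityˡ h)

  shift-shift : ∀ g h x → shift h (shift g x) ≋ shift (g ⊕ h) x
  shift-shift g h (x , _) k = cong x (sym (⊕-assoc g h k))

  shift-⊖ : ∀ g h x → shift ((⊖ g) ⊕ h) (shift g x) ≋ shift h x
  shift-⊖ g h x k = trans (shift-shift g ((⊖ g) ⊕ h) x k) (cong (λ f → proj₁ x (f ⊕ k)) (⊖-cancelʳ g h))

  nbhd-≋ : ∀ hs {x y} → x ≋ y → Nbhd hs x y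
  nbhd-≋ hs {x} {y} x≋y = All.universal (λ h → sym (x≋y h)) hs

  borel-≋ : ∀ {B} → IsBorel B → ∀ x y → x ≋ y → B x → B y
  borel-≋ b x y = F.borel-resp _≋_ (λ x≋y h → sym (x≋y h)) nbhd-≋ b {x} {y}

  borel-shift : ∀ g {B} → IsBorel B → IsBorel (B ∘ shift g)
  borel-shift g = borel-preimage (shift g) λ hs x → List.map (g ⊕_) hs , λ eqs → All.map⁻ eqs

  -- The condition reads only finitely many coordinates, so it is open for every `Q`.
  borel-window : ∀ hs (Q : Pred (List Bool) 0ℓ) → IsBorel (λ (x , _) → Q (List.map x hs))
  borel-window hs Q = F.open-set λ x q → hs , λ eqs → subst Q (sym (map-cong-local eqs)) q

  borel-≢ : ∀ g h → IsBorel (λ (x , _) → x g ≢ x h)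
  borel-≢ g h = F.open-set λ where
    x x≢ → g ∷ h ∷ [] , λ { (eq ∷ eq′ ∷ []) same → x≢ (trans (sym eq) (trans same eq′)) }

  -- Countably many colours with separated classes

  Aperiodic : ℕ → ℕ → Pred Carrier 0ℓ
  Aperiodic r s (x , _) = ∀ g → g ≢ 𝟎 → Near r 𝟎 g → ∃[ h ] Near s 𝟎 h × x (g ⊕ h) ≢ x h

  -- If x and g · x have the same colour, they agree on a box that witnesses the aperiodicity of x, so g = 𝟎.
  Colour : ℕ → ℕ → Pred Carrier 0ℓ
  Colour r i x = ∃[ s ] Aperiodic r s x × ℕᵇ.toℕ (encode s (List.map (proj₁ x) (box s n))) ≡ i

  colour-borel : ∀ r i → IsBorel (Colour r i)
  colour-borel r i = F.union λ s → F.borel-∩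
    (F.borel-⋂ℤⁿ λ g → F.borel-⇒ (F.borel-const _) (F.borel-⇒ (F.borel-const _)
      (F.borel-⋃ℤⁿ λ h → F.borel-∩ (F.borel-const _) (borel-≢ (g ⊕ h) h))))
    (borel-window (box s n) λ bs → ℕᵇ.toℕ (encode s bs) ≡ i)

  -- Each of the finitely many nonzero `g` in the box fails to be a period at some coordinate; `s`
  -- bounds all these coordinates.
  colour-total : ∀ r x → ∃[ i ] Colour r i x
  colour-total r (x , free) =
    let s , aperiodic = uniform-bound Witness mono (All.universal witness (box r n))
    in _ , s , (λ g g≢𝟎 near → All.lookup aperiodic (∈-box g near) g≢𝟎) , refl
    where
    Witness : ℤⁿ → ℕ → Set
    Witness g s = g ≢ 𝟎 → ∃[ h ] Near s 𝟎 h × x (g ⊕ h) ≢ x h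
    mono : ∀ {g s t} → s ≤ t → Witness g s → Witness g t
    mono s≤t w g≢𝟎 = let h , near , x≢ = w g≢𝟎 in h , near-mono s≤t near , x≢
    witness : ∀ g → ∃[ s ] Witness g s
    witness g with em {∃[ h ] x (g ⊕ h) ≢ x h}
    ... | yes (h , x≢) = let s , near = radius h in s , λ _ → h , near , x≢
    -- Here freeness rules out `g ≢ 𝟎`, so the condition is vacuous and any radius would do.
    ... | no none = 0 , λ g≢𝟎 → contradiction period (free g g≢𝟎)
      where
      period : ∀ h → x (g ⊕ h) ≡ x h
      period h with em {x (g ⊕ h) ≡ x h}
      ... | yes eq = eq
      ... | no x≢  = contradiction (h , x≢) none

  colour-separated : ∀ {r i x g} → Near r 𝟎 g → Colour r i x → Colour r i (shift g x) → g ≡ 𝟎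
  colour-separated {r} {i} {x , _} {g} near (s , aperiodic , eq) (t , _ , eq′)
    with em {g ≡ 𝟎}
  ... | yes g≡𝟎 = g≡𝟎
  ... | no g≢𝟎 with refl , same ← encode-injective s t (ℕᵇ.toℕ-injective (trans eq (sym eq′))) =
    let h , near-h , x≢ = aperiodic g g≢𝟎 near
    in contradiction (sym (map-≡⇒≡ (box s n) same (∈-box h near-h))) x≢

  -- Greedy maximal separated subsets

  module MaximalSeparated (r : ℕ) {Y : Pred Carrier 0ℓ} (Y-borel : IsBorel Y) where

    -- `Kept i` is the selection once the colours below `i` are processed. Points of one colour may
    -- enter together, since `colour-separated` keeps them apart.
    Kept : ℕ → Pred Carrier 0ℓ
    Kept zero    x = ⊥
    Kept (suc i) x = Kept i x ⊎ (Y x × Colour r i x × (∀ g → Near r 𝟎 g → ¬ Kept i (shift g x)))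

    Selected : Pred Carrier 0ℓ
    Selected x = ∃[ i ] Kept i x

    kept-borel : ∀ i → IsBorel (Kept i)
    kept-borel zero    = F.borel-const ⊥
    kept-borel (suc i) = F.borel-∪ (kept-borel i) (F.borel-∩ Y-borel (F.borel-∩ (colour-borel r i)
      (F.borel-⋂ℤⁿ λ g → F.borel-⇒ (F.borel-const _) (F.complement (borel-shift g (kept-borel i))))))

    selected-borel : IsBorel Selected
    selected-borel = F.union kept-borel

    selected⇒Y : ∀ {x} → Selected x → Y x
    selected⇒Y (suc i , inj₁ p)       = selected⇒Y (i , p)
    selected⇒Y (suc i , inj₂ (y , _)) = y

    kept-mono : ∀ {i j} → i ≤′ j → ∀ {x} → Kept i x → Kept j x
    kept-mono ≤′-refl       p = p
    kept-mono (≤′-step i≤j) p = inj₁ (kept-mono i≤j p)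

    kept-separated : ∀ i {x g} → Near r 𝟎 g → Kept i x → Kept i (shift g x) → g ≡ 𝟎
    kept-separated (suc i) near (inj₁ p) (inj₁ q) = kept-separated i near p q
    kept-separated (suc i) near (inj₂ (_ , _ , ¬near)) (inj₁ q) = contradiction q (¬near _ near)
    kept-separated (suc i) {x} near (inj₂ (_ , c , _)) (inj₂ (_ , c′ , _)) = colour-separated {x = x} near c c′
    -- The later point is `shift g x`; seen from it, `x` lies at `(⊖ g) ⊕ 𝟎` and would have blocked
    -- it.
    kept-separated (suc i) {x} {g} near (inj₁ p) (inj₂ (_ , _ , ¬near)) =
      contradiction (borel-≋ (kept-borel i) x _ x≋ p) (¬near _ (near-⊖ (near-sym near)))
      where
      x≋ : x ≋ shift ((⊖ g) ⊕ 𝟎) (shift g x)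
      x≋ h = trans (sym (shift-𝟎 x h)) (sym (shift-⊖ g 𝟎 x h))

    selected-separated : ∀ {x g} → Near r 𝟎 g → Selected x → Selected (shift g x) → g ≡ 𝟎
    selected-separated near (i , p) (j , q) = kept-separated (i ⊔ j) near
      (kept-mono (≤⇒≤′ (m≤m⊔n i j)) p) (kept-mono (≤⇒≤′ (m≤n⊔m i j)) q)

    selected-maximal : ∀ {x} → Y x → ∃[ g ] Near r 𝟎 g × Selected (shift g x)
    selected-maximal {x} y with i , c ← colour-total r x | em {∃[ g ] Near r 𝟎 g × Kept i (shift g x)}
    ... | yes (g , near , p) = g , near , i , p
    -- If nothing near `x` is in `Kept i` when its colour `i` comes up, then `x` itself enters.
    ... | no none = 𝟎 , near-refl , suc i ,
      borel-≋ (kept-borel (suc i)) x (shift 𝟎 x) (λ h → sym (shift-𝟎 x h))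
        (inj₂ (y , c , λ g near p → none (g , near , p)))

  -- Boundedly many marker sets that are jointly dense

  module Markers (R : ℕ) .{{_ : NonZero R}} where

    -- The union of the marker sets of stages before `j`. It carries its Borel proof because the
    -- selection at the next stage takes such a proof as an argument.
    Covered : ℕ → Σ[ C ∈ Pred Carrier 0ℓ ] IsBorel C
    Uncovered : ℕ → Pred Carrier 0ℓ
    uncovered-borel : ∀ j → IsBorel (Uncovered j)
    Covered zero    = (λ _ → ⊥) , F.borel-const ⊥
    Covered (suc j) = _ , F.borel-∪ (proj₂ (Covered j)) (MaximalSeparated.selected-borel (6 * R) (uncovered-borel j))
    Uncovered j x = ∀ g → Near R 𝟎 g → ¬ proj₁ (Covered j) (shift g x)
    uncovered-borel j = F.borel-⋂ℤⁿ λ g → F.borel-⇒ (F.borel-const _)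
      (F.complement (borel-shift g (proj₂ (Covered j))))

    module Stage j = MaximalSeparated (6 * R) (uncovered-borel j)
    Marker : ℕ → Pred Carrier 0ℓ
    Marker j = Stage.Selected j

    marker-borel : ∀ j → IsBorel (Marker j)
    marker-borel j = Stage.selected-borel j

    covered⇒marker : ∀ j {x} → proj₁ (Covered j) x → ∃[ i ] i < j × Marker i x
    covered⇒marker (suc j) (inj₂ m) = j , ≤-refl , m
    covered⇒marker (suc j) (inj₁ c) = let i , i<j , m = covered⇒marker j c in i , m<n⇒m<1+n i<j , m

    marker⇒covered : ∀ {i j} → i <′ j → ∀ {x} → Marker i x → proj₁ (Covered j) x
    marker⇒covered ≤′-refl       m = inj₂ m
    marker⇒covered (≤′-step i<j) m = inj₁ (marker⇒covered i<j m)

    marker-separated : ∀ j x {a b} → Marker j (shift a x) → Marker j (shift b x) → Near (6 * R) a b → a ≡ b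
    marker-separated j x {a} {b} p q near = begin
      a                  ≡⟨ ⊕-identityʳ a ⟨
      a ⊕ 𝟎              ≡⟨ cong (a ⊕_) (Stage.selected-separated j (near-⊖ near) p
                              (borel-≋ (marker-borel j) (shift b x) _ (λ h → sym (shift-⊖ a b x h)) q)) ⟨
      a ⊕ ((⊖ a) ⊕ b)    ≡⟨ ⊖-cancelʳ a b ⟩
      b                  ∎
      where open ≡-Reasoning

    -- Otherwise each of the 1 + 13ⁿ stages has a marker 6R-close to x, and markers of distinct stages
    -- are not R-close, contradicting the packing bound.
    marker-dense : ∀ x → ∃[ j ] j < suc (13 ^ n) × ∃[ g ] Near R 𝟎 g × Marker j (shift g x)
    marker-dense x with em {∃[ j ] j < suc (13 ^ n) × ∃[ g ] Near R 𝟎 g × Marker j (shift g x)}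
    ... | yes dense = dense
    ... | no none =
      let i , j , i<j , near = Packing.packing R (proj₁ ∘ close) (proj₁ ∘ proj₂ ∘ close)
          g , _ , p = close i
          h , _ , q = close j
      in contradiction
           (marker⇒covered (<⇒<′ i<j) (borel-≋ (marker-borel (Fin.toℕ i)) (shift g x) _
             (λ k → sym (shift-⊖ h g x k)) p))
           (Stage.selected⇒Y (Fin.toℕ j) q _ (near-⊖ (near-sym near)))
      where
      close : ∀ (j : Fin (suc (13 ^ n))) → ∃[ g ] Near (6 * R) 𝟎 g × Marker (Fin.toℕ j) (shift g x)
      close j = Stage.selected-maximal (Fin.toℕ j) {x} λ g near c →
        let i , i<j , m = covered⇒marker (Fin.toℕ j) c
        in none (i , <-trans i<j (Fin.toℕ<n j) , g , near , m)

  -- One recurrent marker index for each orbit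

  module Recurrence
    (Marker : ℕ → ℕ → Pred Carrier 0ℓ) (marker-borel : ∀ k j → IsBorel (Marker k j))
    (marker-separated : ∀ k j x {a b} → Marker k j (shift a x) → Marker k j (shift b x) →
                        Near (6 * scale k) a b → a ≡ b)
    (N : ℕ) (marker-dense : ∀ k x → ∃[ j ] j < N × ∃[ g ] Near (scale k) 𝟎 g × Marker k j (shift g x))
    where

    -- t + r ≤ 2 scale k puts the whole r-ball around x inside the 2 scale k-ball around the marker.
    Deep : ℕ → Carrier → ℕ → Set
    Deep j x r = ∃[ k ] r < k × ∃[ m ] Marker k j (shift m x) × ∃[ t ] Near t 𝟎 m × t + r ≤ scale k + scale k

    Recurrent : ℕ → Pred Carrier 0ℓ
    Recurrent j x = ∀ r → Deep j x r

    Chosen : ℕ → Pred Carrier 0ℓ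
    Chosen j x = Recurrent j x × (∀ i → i < j → ¬ Recurrent i x)

    Centre : ℕ → Pred Carrier 0ℓ
    Centre k x = ∃[ j ] Chosen j x × Marker k j x

    recurrent-borel : ∀ j → IsBorel (Recurrent j)
    recurrent-borel j = F.borel-⋂ F.union λ r → F.union λ k → F.borel-∩ (F.borel-const _)
      (F.borel-⋃ℤⁿ λ m → F.borel-∩ (borel-shift m (marker-borel k j)) (F.borel-const _))

    centre-borel : ∀ k → IsBorel (Centre k)
    centre-borel k = F.union λ j → F.borel-∩
      (F.borel-∩ (recurrent-borel j)
        (F.borel-⋂ F.union λ i → F.borel-⇒ (F.borel-const _) (F.complement (recurrent-borel i))))
      (marker-borel k j)

    -- Moving the base point by distance `s` costs depth `s`, so depth `s + r` is requested at `x`.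
    recurrent-shift : ∀ c {j} x → Recurrent j x → Recurrent j (shift c x)
    recurrent-shift c {j} x rec r =
      let s , near-c = radius c
          k , r<k , m , p , t , near , t≤ = rec (s + r)
      in k , ≤-<-trans (m≤n+m r s) r<k ,
         (⊖ c) ⊕ m , borel-≋ (marker-borel k j) (shift m x) _ (λ h → sym (shift-⊖ c m x h)) p ,
         s + t , near-⊖ (near-trans (near-sym near-c) near) ,
         subst (_≤ scale k + scale k) (reorder t s r) t≤
      where
      reorder : ∀ t s r → t + (s + r) ≡ (s + t) + r
      reorder t s r = trans (sym (+-assoc t s r)) (cong (_+ r) (+-comm t s))

    recurrent-unshift : ∀ c {j} x → Recurrent j (shift c x) → Recurrent j x
    recurrent-unshift c {j} x rec =
      borel-≋ (recurrent-borel j) (shift ((⊖ c) ⊕ 𝟎) (shift c x)) x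
        (λ h → trans (shift-⊖ c 𝟎 x h) (shift-𝟎 x h)) (recurrent-shift ((⊖ c) ⊕ 𝟎) (shift c x) rec)

    chosen-shift : ∀ c {j} x → Chosen j x → Chosen j (shift c x)
    chosen-shift c x (rec , least) =
      recurrent-shift c x rec , λ i i<j rec′ → least i i<j (recurrent-unshift c x rec′)

    chosen-unshift : ∀ c {j} x → Chosen j (shift c x) → Chosen j x
    chosen-unshift c x (rec , least) =
      recurrent-unshift c x rec , λ i i<j rec′ → least i i<j (recurrent-shift c x rec′)

    chosen-unique : ∀ {i j} x → Chosen i x → Chosen j x → i ≡ j
    chosen-unique {i} {j} x (rec , least) (rec′ , least′) with <-cmp i j
    ... | tri< i<j _ _ = contradiction rec (least′ i i<j)
    ... | tri≈ _ i≡j _ = i≡j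
    ... | tri> _ _ j<i = contradiction rec′ (least j j<i)

    chosen-or-none : ∀ M x → (∃[ j ] Chosen j x) ⊎ (∀ i → i < M → ¬ Recurrent i x)
    chosen-or-none zero    x = inj₂ λ _ ()
    chosen-or-none (suc M) x with chosen-or-none M x | em {Recurrent M x}
    ... | inj₁ found | _       = inj₁ found
    ... | inj₂ none  | yes rec = inj₁ (M , rec , none)
    ... | inj₂ none  | no ¬rec = inj₂ λ i i<1+M →
      [ none i , (λ { refl → ¬rec }) ] (m≤n⇒m<n∨m≡n (≤-pred i<1+M))

    deep-mono : ∀ {j} x {r s} → r ≤ s → Deep j x s → Deep j x r
    deep-mono x r≤s (k , s<k , m , p , t , near , t≤) =
      k , ≤-<-trans r≤s s<k , m , p , t , near , ≤-trans (+-monoʳ-≤ t r≤s) t≤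

    ¬recurrent⇒shallow : ∀ {j} x → ¬ Recurrent j x → ∃[ r ] ¬ Deep j x r
    ¬recurrent⇒shallow {j} x ¬rec with em {∃[ r ] ¬ Deep j x r}
    ... | yes found = found
    ... | no none   = contradiction deep ¬rec
      where
      deep : Recurrent j x
      deep r with em {Deep j x r}
      ... | yes d = d
      ... | no ¬d = contradiction (r , ¬d) none

    -- If no index below `N` recurs, there is a depth `r` that none of them attains. But at level
    -- `suc r` some such index has a marker within `scale (suc r)` of `x`, and the doubled radius
    -- leaves depth at least `r`.
    chosen-exists : ∀ x → ∃[ j ] Chosen j x
    chosen-exists x with chosen-or-none N x
    ... | inj₁ found = found
    ... | inj₂ none  =
      let r , shallow = uniform-bound (λ j r → ¬ Deep j x r) (λ r≤s ¬d d → ¬d (deep-mono x r≤s d))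
                          (All.tabulate {xs = List.upTo N} λ {j} j∈ → ¬recurrent⇒shallow x (none j (∈-upTo⁻ j∈)))
          j , j<N , g , near , m = marker-dense (suc r) x
      in contradiction
           (suc r , ≤-refl , g , m , scale (suc r) , near ,
            +-monoʳ-≤ (scale (suc r)) (≤-trans (n≤1+n r) (m≤n⇒m≤1+n (n≤diameter (suc r)))))
           (All.lookup shallow (∈-upTo⁺ j<N))

    -- The chosen index is constant on an orbit, so both centres come from the same separated marker
    -- set.
    centre-separated : ∀ k x {a b} → Centre k (shift a x) → Centre k (shift b x) → Near (6 * scale k) a b → a ≡ b
    centre-separated k x {a} {b} (i , c , p) (j , c′ , q) near
      with refl ← chosen-unique x (chosen-unshift a x c) (chosen-unshift b x c′) =
      marker-separated k i x p q near

    centre-deep : ∀ x r → ∃[ k ] r < k × ∃[ m ] Centre k (shift m x) ×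
                          ∃[ t ] Near t 𝟎 m × t + r ≤ scale k + scale k
    centre-deep x r =
      let j , chosen = chosen-exists x
          k , r<k , m , p , rest = proj₁ chosen r
      in k , r<k , m , (j , chosen-shift m x chosen , p) , rest

-- The standard generators

-- The tail is built first, with head coordinate `0ℤ`; then the head is reached by unit steps up or
-- down.
generator-induction : ∀ {n} → let open Shift n in (P : Pred ℤⁿ 0ℓ) → P 𝟎 →
  (∀ {s} → IsGenerator s → ∀ {g} → P g → P (s ⊕ g)) → ∀ g → P g
generator-induction P base step []      = base
generator-induction {suc n} P base step (z ∷ g) = head z
  where
  open Shift n
  P-0∷ : P (0ℤ ∷ g)
  P-0∷ = generator-induction (λ h → P (0ℤ ∷ h)) base
    (λ { (i , inj₁ refl) → step (Fin.suc i , inj₁ refl)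
       ; (i , inj₂ refl) → step (Fin.suc i , inj₂ refl) }) g
  ⊖𝟎⊕ : ∀ g → (⊖ 𝟎) ⊕ g ≡ g
  ⊖𝟎⊕ g = trans (cong ((⊖ 𝟎) ⊕_) (sym (⊕-identityˡ g))) (⊖-cancelˡ 𝟎 g)
  head : ∀ z → P (z ∷ g)
  head (+ zero)     = P-0∷
  head (+ suc k)    = subst (λ h → P (+ suc k ∷ h)) (⊕-identityˡ g) (step (Fin.zero , inj₁ refl) (head (+ k)))
  head -[1+ zero ]  = subst (λ h → P (-[1+ 0 ] ∷ h)) (⊖𝟎⊕ g) (step (Fin.zero , inj₂ refl) P-0∷)
  head -[1+ suc k ] = subst (λ h → P (-[1+ suc k ] ∷ h)) (⊖𝟎⊕ g) (step (Fin.zero , inj₂ refl) (head -[1+ k ]))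

generator-near : ∀ {n} {s} → Shift.IsGenerator n s → Near 1 (Shift.𝟎 n) s
generator-near (i , inj₁ refl) = go i
  where
  go : ∀ {n} (i : Fin n) → Near 1 (Shift.𝟎 n) (Shift.e n i)
  go Fin.zero    = ≤-refl ∷ near-refl
  go (Fin.suc i) = z≤n ∷ go i
generator-near (i , inj₂ refl) = go i
  where
  ⊖𝟎 : ∀ n → Near 1 (Shift.𝟎 n) (Shift.⊖_ n (Shift.𝟎 n))
  ⊖𝟎 zero    = []
  ⊖𝟎 (suc n) = z≤n ∷ ⊖𝟎 n
  go : ∀ {n} (i : Fin n) → Near 1 (Shift.𝟎 n) (Shift.⊖_ n (Shift.e n i))
  go Fin.zero    = ≤-refl ∷ ⊖𝟎 _
  go (Fin.suc i) = z≤n ∷ go i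

-- From tiles to a Borel toast

module ToastConstruction (em : ExcludedMiddle 0ℓ) (n : ℕ) where
  open Shift n
  open Construction em n
  open F using (IsBorel)
  open Setoid F using (Carrier) renaming (_≈_ to _≋_)
  open Graph F SchreierEdge using (Connected)

  shift-connected : ∀ g x y → y ≋ shift g x → Connected x y
  shift-connected = generator-induction (λ g → ∀ x y → y ≋ shift g x → Connected x y)
    (λ x y y≋ → 0 , λ h → sym (trans (y≋ h) (shift-𝟎 x h)))
    (λ {s} gen {g} rec x y y≋ →
      let k , walk = rec (shift s x) y (λ h → trans (y≋ h) (sym (shift-shift s g x h)))
      in suc k , shift s x , (s , gen , λ _ → refl) , walk)

  module _ (Centre : ℕ → Pred Carrier 0ℓ) (centre-borel : ∀ k → IsBorel (Centre k))
    (centre-separated : ∀ k x {a b} → Centre k (shift a x) → Centre k (shift b x) →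
                        Near (6 * scale k) a b → a ≡ b)
    (centre-deep : ∀ x r → ∃[ k ] r < k × ∃[ m ] Centre k (shift m x) ×
                           ∃[ t ] Near t 𝟎 m × t + r ≤ scale k + scale k)
    where

    centres : Carrier → ℕ → Pred ℤⁿ 0ℓ
    centres x k h = Centre k (shift h x)

    centres-shift : ∀ g x y → y ≋ shift g x → ∀ k m → centres y k m → centres x k (g ⊕ m)
    centres-shift g x y y≋ k m = borel-≋ (centre-borel k) (shift m y) (shift (g ⊕ m) x)
      λ h → trans (y≋ (m ⊕ h)) (shift-shift g m x h)

    ≋-unshift : ∀ g x y → y ≋ shift g x → x ≋ shift (⊖ g) y
    ≋-unshift g x y y≋ h = sym (trans (y≋ _) (cong (proj₁ x) (⊖-cancelʳ g h)))

    infix 4 _≈[_]_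
    -- Coordinates are based at the left point; `centres-shift` changes the base.
    _≈[_]_ : Carrier → ℕ → Carrier → Set
    x ≈[ k ] y = ∃[ g ] y ≋ shift g x × SameTile (centres x) k 𝟎 g

    -- `SameTile` is reflexive only on tiles, so this says that `x` lies in a tile of level `k`.
    Domain : ℕ → Pred Carrier 0ℓ
    Domain k x = SameTile (centres x) k 𝟎 𝟎

    toast-refl : ∀ k x → Domain k x → x ≈[ k ] x
    toast-refl k x t = 𝟎 , (λ h → sym (shift-𝟎 x h)) , t

    toast-sym : ∀ k x y → x ≈[ k ] y → y ≈[ k ] x
    toast-sym k x y (g , y≋ , t) = ⊖ g , ≋-unshift g x y y≋ ,
      subst₂ (SameTile (centres y) k) (⊖-inverseˡ g) (⊕-identityʳ (⊖ g))
        (tile-shift (⊖ g) (centres-shift (⊖ g) y x (≋-unshift g x y y≋)) k (tile-sym k t))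

    -- The case `k = m` is transitivity and `k < m` yields nestedness. The second relation is first
    -- moved to coordinates based at `x`.
    toast-absorbs : ∀ {k m} → k ≤ m → ∀ x y z → x ≈[ m ] y → y ≈[ k ] z → x ≈[ m ] z
    toast-absorbs {k} {m} k≤m x y z (g , y≋ , t) (h , z≋ , t′) =
      g ⊕ h , (λ f → trans (z≋ f) (trans (y≋ (h ⊕ f)) (shift-shift g h x f))) ,
      tile-absorbs (λ k p q → centre-separated k x p q) k≤m t
        (subst (λ f → SameTile (centres x) k f (g ⊕ h)) (⊕-identityʳ g)
          (tile-shift g (centres-shift g x y y≋) k t′))

    toast-domainˡ : ∀ k x y → x ≈[ k ] y → Domain k x
    toast-domainˡ k x y (g , _ , t) = tile-trans (λ k p q → centre-separated k x p q) k t (tile-sym k t)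

    below-borel : ∀ k a b → IsBorel (λ x → Below (centres x) k a b)
    tile-borel : ∀ k a b → IsBorel (λ x → SameTile (centres x) k a b)
    below-borel zero    a b = F.borel-const (a ≡ b)
    below-borel (suc k) a b = F.borel-∪ (below-borel k a b) (tile-borel k a b)
    tile-borel k a b = F.borel-⋃ℤⁿ λ m → F.borel-∩ (borel-shift m (centre-borel k))
      (F.borel-∩ (saturation a m) (saturation b m))
      where
      saturation : ∀ a m → IsBorel (λ x → Saturation (scale k) (Below (centres x) k) m a)
      saturation a m = F.borel-⋃ℤⁿ λ a′ → F.borel-∩ (below-borel k a a′) (F.borel-const _)

    -- A countable union over `g`: the graph of `shift g` is a countable intersection of open sets,
    -- and the tile condition depends on `x` alone.
    toast-borel : ∀ k → F².IsBorel (uncurry (_≈[ k ]_))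
    toast-borel k = F².borel-⋃ℤⁿ λ g → F².borel-∩ (graph g)
      (borel-preimage {N = ProductNbhd Nbhd Nbhd} proj₁ (λ hs _ → (hs , []) , proj₁) (tile-borel k 𝟎 g))
      where
      graph : ∀ g → F².IsBorel (λ (x , y) → y ≋ shift g x)
      graph g = F².borel-⋂ℤⁿ λ h → F².open-set λ (x , y) eq →
        (g ⊕ h ∷ [] , h ∷ []) , λ { (eqx ∷ [] , eqy ∷ []) → trans eqy (trans eq (sym eqx)) }

    toast : ℕ → EquivalenceOnSubset F
    toast k = record
      { dom      = Domain k
      ; _∼_      = _≈[ k ]_
      ; dom-resp = λ {x} {y} → borel-≋ (tile-borel k 𝟎 𝟎) x y
      ; ∼-resp   = (λ {x} {y} {y′} → toast-respʳ x y y′)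
                 , (λ {x} {y} {y′} y≋y′ r → toast-sym k x y′ (toast-respʳ x y y′ y≋y′ (toast-sym k y x r)))
      ; ∼⇒dom    = λ {x} {y} r → toast-domainˡ k x y r , toast-domainˡ k y x (toast-sym k x y r)
      ; refl     = λ {x} → toast-refl k x
      ; sym      = λ {x} {y} → toast-sym k x y
      ; trans    = λ {x} {y} {z} → toast-absorbs ≤-refl x y z
      }
      where
      toast-respʳ : ∀ x y y′ → y ≋ y′ → x ≈[ k ] y → x ≈[ k ] y′
      toast-respʳ x y y′ y≋y′ (g , y≋ , t) = g , (λ h → trans (sym (y≋y′ h)) (y≋ h)) , t

    toast-finite : ∀ k x → Graph.IsFinite F SchreierEdge (x ≈[ k ]_)
    toast-finite k x = List.map (λ g → shift g x) (box (diameter (suc k)) n) ,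
      λ (g , y≋ , t) → Any.map⁺ (Any.map (λ { refl → y≋ }) (∈-box g (tile-near k t)))

    toast-covers : ∀ x → ∃[ k ] Domain k x
    toast-covers x =
      let k , _ , m , c , t , near , t≤ = centre-deep x 0
          near′ = near-mono (≤-trans (m≤m+n t 0) t≤) near
      in k , ball⇒tile k c near′ near′

    toast-absorbed : ∀ k x → Domain k x → ∃[ m ] k < m × ∃[ y ] Domain m y ×
      (∀ {z} → x ≈[ k ] z → y ≈[ m ] z × ¬ Graph.∂ F SchreierEdge (y ≈[ m ]_) z)
    toast-absorbed k x _ =
      -- Depth `d` accommodates the whole class of `x`, and the extra 1 its neighbours. As
      -- `suc k ≤ d`, the same request forces `k < m`.
      let m , d<m , c , centre , t , near , t≤ = centre-deep x (suc d)
          ball : ∀ {g} → Near (suc d) 𝟎 g → Near (scale m + scale m) g c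
          ball near-g = near-mono (subst (_≤ scale m + scale m) (+-comm t (suc d)) t≤)
                                  (near-trans (near-sym near-g) near)
          tile : ∀ {g} → Near (suc d) 𝟎 g → SameTile (centres x) m 𝟎 g
          tile near-g = ball⇒tile m centre (ball near-refl) (ball near-g)
      in m , ≤-trans (n≤diameter (suc k)) (≤-trans (n≤1+n d) (<⇒≤ d<m)) , x , tile near-refl ,
         λ {z} (g , z≋ , t) →
           (g , z≋ , tile (near-mono (n≤1+n d) (tile-near k t))) ,
           -- A boundary point would have a neighbour `y` outside the class; but `y` is `g ⊕ s` in
           -- coordinates at `x`, within `d + 1`, hence inside.
           λ { (_ , (y , y∉ , (w , (s , gen , w≋) , w≋y) , _) , _) → y∉
                 ( g ⊕ s
                 , (λ h → trans (sym (w≋y h)) (trans (w≋ h) (trans (z≋ (s ⊕ h)) (shift-shift g s x h))))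
                 , tile (near-mono (≤-reflexive (+-comm d 1))
                     (near-trans (tile-near k t) (near-shift-𝟎 (generator-near gen)))) ) }
      where d = diameter (suc k)

    toast-exists : BorelUnlayeredToast
    toast-exists = toast ,
      record
        { ⊆-connected = λ { k {x} {y} (g , y≋ , _) → shift-connected g x y y≋ }
        ; finite      = λ k x _ → toast-finite k x
        ; covers      = toast-covers
        -- From `y` the common point `z` is reached at level `m`; the steps from `z` to `x` to `w`
        -- have level `k` and are absorbed.
        ; nested      = λ { k m k<m x y _ _ (z , x∼z , y∼z) {w} x∼w →
                          toast-absorbs (<⇒≤ k<m) y z w y∼z
                            (toast-absorbs ≤-refl z x w (toast-sym k x z x∼z) x∼w) }
        ; absorbed    = toast-absorbed
        } ,
      record
        { dom-borel = λ k → tile-borel k 𝟎 𝟎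
        ; ∼-borel   = toast-borel
        }

corollary4p13 : ExcludedMiddle 0ℓ → (n : ℕ) → n ≥ 1 → Shift.BorelUnlayeredToast n
corollary4p13 em n _ = ToastConstruction.toast-exists em n Centre centre-borel centre-separated centre-deep
  where
  open Construction em n
  -- `scale k` is a successor, so its `NonZero` instance is found by unification.
  module AtScale k = Markers (scale k) ⦃ _ ⦄
  -- The bound `suc (13 ^ n)` does not depend on the scale, so one `N` serves all levels.
  open Recurrence AtScale.Marker AtScale.marker-borel AtScale.marker-separated (suc (13 ^ n)) AtScale.marker-dense
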